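{- Suppose $|A|>1$. Then there exists a Hoare-McCarthy algebra $\mathbb{A}^{cr}$ (over the atom set $A$) such that for all closed terms $t,t'\in\mathcal{T}_{\Sigma^A_{ce}}$, $$\mathrm{CP}_{cr}\vdash t=t'\iff \mathbb{A}^{cr}\models t=t'.$$
   Context: Let $A$ be a non-empty, denumerable (finite or countably infinite) set of atoms. $\Sigma^A_{ce}$ is the one-sorted signature with sort $C$ (conditional expressions), constants $T$, $F$ and $a$ (one for each $a\in A$), and a ternary operation $x\triangleleft y\triangleright z$ ("if $y$ then $x$ else $z$"). $\mathcal{T}_{\Sigma^A_{ce}}$ is the set of closed (variable-free) terms over $\Sigma^A_{ce}$. $\mathrm{CP}$ is the set of the four equations (CP1) $x\triangleleft T\triangleright y=x$; (CP2) $x\triangleleft F\triangleright y=y$; (CP3) $T\triangleleft x\triangleright F=x$; (CP4) $x\triangleleft(y\triangleleft z\triangleright u)\triangleright v=(x\triangleleft y\triangleright v)\triangleleft z\triangleright(x\triangleleft u\triangleright v)$. $\mathrm{CP}_{cr}$ is $\mathrm{CP}$ together with, for every $a\in A$, the equations (CPcr1) $(x\triangleleft a\triangleright y)\triangleleft a\triangleright z=x\triangleleft a\triangleright z$; (CPcr2) $x\triangleleft a\triangleright(y\triangleleft a\triangleright z)=x\triangleleft a\triangleright z$. $E\vdash t=t'$ means derivability in equational logic from the set $E$ of equations. A stateful proposition algebra (SPA) is a two-sorted algebra with sorts $C$ and $S$ (states), with the operations of $\Sigma^A_{ce}$ on sort $C$, a constant $c$ of sort $S$, and operations $\cdot\triangleleft\cdot\triangleright\cdot:S\times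 C\times S\to S$, $\bullet:C\times S\to S$ (apply), $!:C\times S\to C$ (reply), satisfying CP on sort $C$ and, for all $x,y,z$ in $C$ and $s,s'$ in $S$ ($\bullet$ and $!$ bind stronger than the conditional): (TS1) $s\triangleleft T\triangleright s'=s$; (TS2) $s\triangleleft F\triangleright s'=s'$; (TS3) if $x\neq T$ and $x\neq F$ then $s\triangleleft x\triangleright s'=c$; (SPA1) $T!s=T$; (SPA2) $F!s=F$; (SPA3) $(x\triangleleft y\triangleright z)!s=x!(y\bullet s)\triangleleft y!s\triangleright z!(y\bullet s)$; (SPA4) $T\bullet s=s$; (SPA5) $F\bullet s=s$; (SPA6) $(x\triangleleft y\triangleright z)\bullet s=x\bullet(y\bullet s)\triangleleft y!s\triangleright z\bullet(y\bullet s)$; (SPA7) $x!s=T$ or $x!s=F$; (SPA8) if $x!s=y!s$ and $x\bullet s=y\bullet s$ for all $s$ in $S$, then $x=y$. A Hoare-McCarthy algebra (HMA) is the $\Sigma^A_{ce}$-reduct of a stateful proposition algebra (i.e. sort $C$ with the operations of $\Sigma^A_{ce}$). -}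

module Defs where

open import Level using (Level; _⊔_) renaming (suc to lsuc)
open import Data.Empty using (⊥)
open import Data.Fin using (Fin)
open import Data.Nat using (ℕ)
open import Data.Product using (Σ; ∃)
open import Data.Sum using (_⊎_)
open import Function.Bundles using (_↔_)
open import Relation.Binary.Bundles using (Setoid)
open import Relation.Binary.PropositionalEquality using (_≡_; _≢_)
open import Relation.Nullary using (¬_)
open import Relation.Unary using (Pred)

private
  variable
    a v w c ℓ : Level

record IsAtomSet (A : Set a) : Set a where
  field
    nonEmpty    : A
    denumerable : (∃ λ n → A ↔ Fin n) ⊎ (A ↔ ℕ)

MoreThanOne : Set a → Set a
MoreThanOne A = Σ A λ x → Σ A λ y → x ≢ y

infix 8 _◁_▷_
infix 4 _≐_

data Term (A : Set a) (V : Set v) : Set (a ⊔ v) where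
  var   : V → Term A V
  T F   : Term A V
  atom  : A → Term A V
  _◁_▷_ : (x y z : Term A V) → Term A V

_[_] : {A : Set a} {V : Set v} {W : Set w} →
       Term A V → (V → Term A W) → Term A W
var i       [ σ ] = σ i
T           [ σ ] = T
F           [ σ ] = F
atom α      [ σ ] = atom α
(x ◁ y ▷ z) [ σ ] = (x [ σ ]) ◁ (y [ σ ]) ▷ (z [ σ ])

OpenTerm : Set a → Set a
OpenTerm A = Term A ℕ

ClosedTerm : Set a → Set a
ClosedTerm A = Term A ⊥

⌈_⌉ : {A : Set a} → ClosedTerm A → OpenTerm A
⌈ t ⌉ = t [ (λ ()) ]

record Equation (A : Set a) : Set a where
  constructor _≐_
  field
    lhs rhs : OpenTerm A

module _ {A : Set a} where

  private
    x y z u w′ : OpenTerm A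
    x  = var 0
    y  = var 1
    z  = var 2
    u  = var 3
    w′ = var 4

  data CP : Pred (Equation A) a where
    CP1 : CP (x ◁ T ▷ y ≐ x)
    CP2 : CP (x ◁ F ▷ y ≐ y)
    CP3 : CP (T ◁ x ▷ F ≐ x)
    CP4 : CP (x ◁ (y ◁ z ▷ u) ▷ w′ ≐ (x ◁ y ▷ w′) ◁ z ▷ (x ◁ u ▷ w′))

  data CPcr : Pred (Equation A) a where
    cp    : ∀ {e} → CP e → CPcr e
    CPcr1 : ∀ α → CPcr ((x ◁ atom α ▷ y) ◁ atom α ▷ z ≐ x ◁ atom α ▷ z)
    CPcr2 : ∀ α → CPcr (x ◁ atom α ▷ (y ◁ atom α ▷ z) ≐ x ◁ atom α ▷ z)

infix 3 _⊢_

data _⊢_ {A : Set a} (E : Pred (Equation A) ℓ) : Pred (Equation A) (a ⊔ ℓ) where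
  axiom : ∀ {e} → E e → E ⊢ e
  refl  : ∀ {t} → E ⊢ t ≐ t
  sym   : ∀ {t t′} → E ⊢ t ≐ t′ → E ⊢ t′ ≐ t
  trans : ∀ {t t′ t″} → E ⊢ t ≐ t′ → E ⊢ t′ ≐ t″ → E ⊢ t ≐ t″
  cong  : ∀ {x x′ y y′ z z′} → E ⊢ x ≐ x′ → E ⊢ y ≐ y′ → E ⊢ z ≐ z′ →
          E ⊢ x ◁ y ▷ z ≐ x′ ◁ y′ ▷ z′
  subst : ∀ {t t′} (σ : ℕ → OpenTerm A) → E ⊢ t ≐ t′ →
          E ⊢ t [ σ ] ≐ t′ [ σ ]

-- Equality of elements is the equivalence of a setoid, so that carriers
-- may be quotients; every operation is therefore required to respect it.
record CEAlgebra (A : Set a) (c ℓ : Level) : Set (a ⊔ lsuc (c ⊔ ℓ)) where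
  field
    setoid : Setoid c ℓ

  open Setoid setoid public using (Carrier; _≈_)

  field
    true false : Carrier
    ⟨_⟩        : A → Carrier
    cond       : (x y z : Carrier) → Carrier
    cond-cong  : ∀ {x x′ y y′ z z′} → x ≈ x′ → y ≈ y′ → z ≈ z′ →
                 cond x y z ≈ cond x′ y′ z′

module _ {A : Set a} (𝔸 : CEAlgebra A c ℓ) where
  open CEAlgebra 𝔸

  eval : {V : Set v} → (V → Carrier) → Term A V → Carrier
  eval ρ (var i)     = ρ i
  eval ρ T           = true
  eval ρ F           = false
  eval ρ (atom α)    = ⟨ α ⟩
  eval ρ (x ◁ y ▷ z) = cond (eval ρ x) (eval ρ y) (eval ρ z)

  infix 3 _⊨_

  _⊨_ : Equation A → Set (c ⊔ ℓ)
  _⊨_ (t ≐ t′) = (ρ : ℕ → Carrier) → eval ρ t ≈ eval ρ t′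

-- cond x y z and condₛ s x s′ stand for x ◁ y ▷ z and s ◁ x ▷ s′:
-- the condition is the middle argument.
record SPA (A : Set a) (c ℓ : Level) : Set (a ⊔ lsuc (c ⊔ ℓ)) where
  field
    reduct : CEAlgebra A c ℓ
    states : Setoid c ℓ

  open CEAlgebra reduct public
    renaming (Carrier to C) hiding (setoid)
  open Setoid states public
    using () renaming (Carrier to S; _≈_ to _≈ₛ_)

  infixr 9 _•_ _!_
  infix 4 _≉_

  _≉_ : C → C → Set ℓ
  x ≉ y = ¬ (x ≈ y)

  field
    const : S
    condₛ : S → C → S → S
    _•_   : C → S → S
    _!_   : C → S → C

    condₛ-cong : ∀ {s s′ x x′ r r′} → s ≈ₛ s′ → x ≈ x′ → r ≈ₛ r′ →
                 condₛ s x r ≈ₛ condₛ s′ x′ r′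
    •-cong     : ∀ {x x′ s s′} → x ≈ x′ → s ≈ₛ s′ → x • s ≈ₛ x′ • s′
    !-cong     : ∀ {x x′ s s′} → x ≈ x′ → s ≈ₛ s′ → x ! s ≈ x′ ! s′

    satisfiesCP : ∀ {e} → CP e → reduct ⊨ e

    TS1 : ∀ s s′ → condₛ s true s′ ≈ₛ s
    TS2 : ∀ s s′ → condₛ s false s′ ≈ₛ s′
    TS3 : ∀ x s s′ → x ≉ true → x ≉ false → condₛ s x s′ ≈ₛ const

    SPA1 : ∀ s → true ! s ≈ true
    SPA2 : ∀ s → false ! s ≈ false
    SPA3 : ∀ x y z s →
           cond x y z ! s ≈ cond (x ! (y • s)) (y ! s) (z ! (y • s))
    SPA4 : ∀ s → true • s ≈ₛ s
    SPA5 : ∀ s → false • s ≈ₛ s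
    SPA6 : ∀ x y z s →
           cond x y z • s ≈ₛ condₛ (x • (y • s)) (y ! s) (z • (y • s))
    SPA7 : ∀ x s → (x ! s ≈ true) ⊎ (x ! s ≈ false)
    SPA8 : ∀ x y → (∀ s → x ! s ≈ y ! s) → (∀ s → x • s ≈ₛ y • s) → x ≈ y

IsHMA : {A : Set a} → CEAlgebra A c ℓ → Set (a ⊔ lsuc (c ⊔ ℓ))
IsHMA {c = c} {ℓ = ℓ} {A = A} 𝔸 = Σ (SPA A c ℓ) λ M → SPA.reduct M ≡ 𝔸

{-# OPTIONS --safe #-}
module Submission where

-- A state is the path of atoms evaluated so far together with their replies,
-- and a stream of replies to come.  Evaluating the last atom of the path once
-- more repeats its reply and changes nothing; any other atom is appended to
-- the path and takes the next reply from the stream.  Closed terms, identified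
-- when they act alike on all states, form a Hoare-McCarthy algebra in which
-- CPcr holds.  Conversely CPcr rewrites a closed term to a decision tree in
-- which no atom occurs directly below itself, and distinct trees of that kind
-- are separated by some stream: the path records which atoms were evaluated.

open import Level using (Level)
open import Data.Bool using (Bool; true; false)
import Data.Fin.Properties as Fin
open import Data.List using (List; []; _∷_; _++_)
open import Data.List.Properties using (++-assoc; ++-cancelʳ; ++-conicalʳ; ∷ʳ-injectiveʳ)
open import Data.Maybe using (Maybe; just; nothing)
open import Data.Nat using (ℕ; zero; suc)
import Data.Nat.Properties as ℕ
open import Data.Product using (Σ; ∃; _×_; _,_; proj₁; proj₂)
open import Data.Sum using (_⊎_; inj₁; inj₂)
open import Function using (_∘_; const)
open import Function.Bundles using (_⇔_; mk⇔)
open import Function.Properties.Inverse using (↔⇒↣)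
open import Relation.Binary using (DecidableEquality; Setoid)
open import Relation.Binary.PropositionalEquality as ≡ using (_≡_; _≢_)
open import Relation.Nullary using (yes; no; contradiction)
open import Relation.Nullary.Decidable using (via-injection)
open import Relation.Unary using (Pred)
open import Defs

private
  variable
    a c ℓ ℓ′ : Level

-- Denumerability gives an injection into `Fin n` or `ℕ`, which transports their decidable equality;
-- `known` compares atoms with it.
atom-≟ : {A : Set a} → IsAtomSet A → DecidableEquality A
atom-≟ atoms with IsAtomSet.denumerable atoms
... | inj₁ (_ , A↔Fin) = via-injection (↔⇒↣ A↔Fin) Fin._≟_
... | inj₂ A↔ℕ         = via-injection (↔⇒↣ A↔ℕ) ℕ._≟_

-- Soundness of equational logic

module _ {A : Set a} (𝔸 : CEAlgebra A c ℓ) where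
  open CEAlgebra 𝔸
  private module ≈ = Setoid setoid

  eval-[] : ∀ {v w} {V : Set v} {W : Set w} (ρ : W → Carrier) (σ : V → Term A W) t →
            eval 𝔸 ρ (t [ σ ]) ≡ eval 𝔸 (eval 𝔸 ρ ∘ σ) t
  eval-[] ρ σ (var i)  = ≡.refl
  eval-[] ρ σ T        = ≡.refl
  eval-[] ρ σ F        = ≡.refl
  eval-[] ρ σ (atom α) = ≡.refl
  eval-[] ρ σ (x ◁ y ▷ z)
    rewrite eval-[] ρ σ x | eval-[] ρ σ y | eval-[] ρ σ z = ≡.refl

  ⊢-sound : {E : Pred (Equation A) ℓ′} → (∀ {e} → E e → 𝔸 ⊨ e) → ∀ {e} → E ⊢ e → 𝔸 ⊨ e
  ⊢-sound ⊨E (axiom e)   ρ = ⊨E e ρ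
  ⊢-sound ⊨E refl        ρ = ≈.refl
  ⊢-sound ⊨E (sym d)     ρ = ≈.sym (⊢-sound ⊨E d ρ)
  ⊢-sound ⊨E (trans d e) ρ = ≈.trans (⊢-sound ⊨E d ρ) (⊢-sound ⊨E e ρ)
  ⊢-sound ⊨E (cong d e f) ρ =
    cond-cong (⊢-sound ⊨E d ρ) (⊢-sound ⊨E e ρ) (⊢-sound ⊨E f ρ)
  ⊢-sound ⊨E (subst {t} {t′} σ d) ρ
    rewrite eval-[] ρ σ t | eval-[] ρ σ t′ = ⊢-sound ⊨E d (eval 𝔸 ρ ∘ σ)

-- States, execution and the algebra of closed terms

module _ {A : Set a} (_≟_ : DecidableEquality A) where

  -- The most recent atom comes first.
  Path : Set a
  Path = List (A × Bool)

  State : Set a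
  State = Path × (ℕ → Bool)

  -- Only the head of the path is consulted, because `CPcr` merges immediate repetitions of an atom
  -- only.
  known : A → Path → Maybe Bool
  known α []            = nothing
  known α ((β , b) ∷ h) with α ≟ β
  ... | yes _ = just b
  ... | no  _ = nothing

  known-here : ∀ α b h → known α ((α , b) ∷ h) ≡ just b
  known-here α b h with α ≟ α
  ... | yes _   = ≡.refl
  ... | no  α≢α = contradiction ≡.refl α≢α

  known-just : ∀ α h {b} → known α h ≡ just b → ∃ λ h′ → h ≡ (α , b) ∷ h′
  known-just α ((β , b) ∷ h) eq with α ≟ β
  known-just α ((β , b) ∷ h) ≡.refl | yes ≡.refl = h , ≡.refl

  -- The lookup result is a separate argument, so that abstracting over `known α h` lets a query
  -- compute.
  answer : A → State → Maybe Bool → Bool × State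
  answer α s       (just b) = b , s
  answer α (h , q) nothing  = q 0 , (α , q 0) ∷ h , q ∘ suc

  query : A → State → Bool × State
  query α (h , q) = answer α (h , q) (known α h)

  -- A fresh query puts `α` at the head of the path, where the second query finds it. This makes
  -- `CPcr1` and `CPcr2` valid.
  query-idem : ∀ α s → query α (proj₂ (query α s)) ≡ query α s
  query-idem α (h , q) with known α h in eq
  ... | just b  rewrite eq = ≡.refl
  ... | nothing rewrite known-here α (q 0) h = ≡.refl

  branch : ∀ {r} {R : Set r} (f g : State → R) → Bool × State → R
  branch f g (true  , s) = f s
  branch f g (false , s) = g s

  run : ClosedTerm A → State → Bool × State
  run T           s = true , s
  run F           s = false , s
  run (atom α)    s = query α s
  run (x ◁ y ▷ z) s = branch (run x) (run z) (run y s)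

  infix 4 _≃_

  -- Wrapped in a record so that the two terms can be inferred from a proof.
  record _≃_ (x y : ClosedTerm A) : Set a where
    constructor pointwise
    field at : ∀ s → run x s ≡ run y s

  open _≃_

  ≃-setoid : Setoid a a
  ≃-setoid = record
    { Carrier       = ClosedTerm A
    ; _≈_           = _≃_
    ; isEquivalence = record
      { refl  = pointwise λ _ → ≡.refl
      ; sym   = λ e → pointwise λ s → ≡.sym (at e s)
      ; trans = λ e f → pointwise λ s → ≡.trans (at e s) (at f s)
      }
    }

  ◁▷-cong : ∀ {x x′ y y′ z z′} → x ≃ x′ → y ≃ y′ → z ≃ z′ → x ◁ y ▷ z ≃ x′ ◁ y′ ▷ z′
  at (◁▷-cong {y = y} {y′} ex ey ez) s rewrite at ey s with run y′ s
  ... | true  , s′ = at ex s′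
  ... | false , s′ = at ez s′

  𝔸cr : CEAlgebra A a a
  𝔸cr = record
    { setoid    = ≃-setoid
    ; true      = T
    ; false     = F
    ; ⟨_⟩       = atom
    ; cond      = _◁_▷_
    ; cond-cong = ◁▷-cong
    }

  ⊨CP : ∀ {e} → CP e → 𝔸cr ⊨ e
  ⊨CP CP1 ρ = pointwise λ _ → ≡.refl
  ⊨CP CP2 ρ = pointwise λ _ → ≡.refl
  at (⊨CP CP3 ρ) s with run (ρ 0) s
  ... | true  , _ = ≡.refl
  ... | false , _ = ≡.refl
  at (⊨CP CP4 ρ) s with run (ρ 2) s
  ... | true  , _ = ≡.refl
  ... | false , _ = ≡.refl

  ⊨CPcr : ∀ {e} → CPcr e → 𝔸cr ⊨ e
  ⊨CPcr (cp e) ρ = ⊨CP e ρ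
  at (⊨CPcr (CPcr1 α) ρ) s with query α s | query-idem α s
  ... | true  , s′ | idem rewrite idem = ≡.refl
  ... | false , s′ | idem = ≡.refl
  at (⊨CPcr (CPcr2 α) ρ) s with query α s | query-idem α s
  ... | true  , s′ | idem = ≡.refl
  ... | false , s′ | idem rewrite idem = ≡.refl

  -- The carrier consists of the closed terms themselves, with syntactic operations.
  eval-⌈⌉ : ∀ ρ t → eval 𝔸cr ρ ⌈ t ⌉ ≡ t
  eval-⌈⌉ ρ T        = ≡.refl
  eval-⌈⌉ ρ F        = ≡.refl
  eval-⌈⌉ ρ (atom α) = ≡.refl
  eval-⌈⌉ ρ (x ◁ y ▷ z) =
    ≡.cong₂ (λ f t → f t) (≡.cong₂ _◁_▷_ (eval-⌈⌉ ρ x) (eval-⌈⌉ ρ y)) (eval-⌈⌉ ρ z)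

  ⊨⇒≃ : ∀ t t′ → 𝔸cr ⊨ (⌈ t ⌉ ≐ ⌈ t′ ⌉) → t ≃ t′
  ⊨⇒≃ t t′ e = ≡.subst₂ _≃_ (eval-⌈⌉ (const T) t) (eval-⌈⌉ (const T) t′) (e (const T))

  ⊢⇒≃ : ∀ t t′ → CPcr ⊢ (⌈ t ⌉ ≐ ⌈ t′ ⌉) → t ≃ t′
  ⊢⇒≃ t t′ d = ⊨⇒≃ t t′ (⊢-sound 𝔸cr ⊨CPcr d)

  -- Normal forms by symbolic execution

  data Normal (h : Path) : ClosedTerm A → Set a where
    T    : Normal h T
    F    : Normal h F
    node : ∀ {α l r} → known α h ≡ nothing →
           Normal ((α , true) ∷ h) l → Normal ((α , false) ∷ h) r →
           Normal h (l ◁ atom α ▷ r)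

  Continuation : Set a
  Continuation = Bool → Path → ClosedTerm A

  ask : A → Path → Continuation → Maybe Bool → ClosedTerm A
  ask α h k (just b) = k b h
  ask α h k nothing  = k true ((α , true) ∷ h) ◁ atom α ▷ k false ((α , false) ∷ h)

  -- Symbolic execution of a term along all paths extending the given one.
  expand : ClosedTerm A → Path → Continuation → ClosedTerm A
  expand T           h k = k true h
  expand F           h k = k false h
  expand (atom α)    h k = ask α h k (known α h)
  expand (x ◁ y ▷ z) h k =
    expand y h λ { true h′ → expand x h′ k ; false h′ → expand z h′ k }

  leaf : Bool → ClosedTerm A
  leaf true  = T
  leaf false = F

  nf : ClosedTerm A → ClosedTerm A
  nf t = expand t [] λ b _ → leaf b

  expand-normal : ∀ t h k → (∀ b h′ → Normal h′ (k b h′)) → Normal h (expand t h k)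
  expand-normal T h k nk = nk true h
  expand-normal F h k nk = nk false h
  expand-normal (atom α) h k nk with known α h in eq
  ... | just b  = nk b h
  ... | nothing = node eq (nk true _) (nk false _)
  expand-normal (x ◁ y ▷ z) h k nk = expand-normal y h _
    λ { true  h′ → expand-normal x h′ k nk
      ; false h′ → expand-normal z h′ k nk }

  nf-normal : ∀ t → Normal [] (nf t)
  nf-normal t = expand-normal t [] _ λ { true _ → T ; false _ → F }

  -- Derivability of normal forms

  sub : (x y z u v : OpenTerm A) → ℕ → OpenTerm A
  sub x y z u v 0 = x
  sub x y z u v 1 = y
  sub x y z u v 2 = z
  sub x y z u v 3 = u
  sub x y z u v _ = v

  ⊢CP1 : ∀ x y → CPcr ⊢ x ◁ T ▷ y ≐ x
  ⊢CP1 x y = subst (sub x y T T T) (axiom (cp CP1))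

  ⊢CP2 : ∀ x y → CPcr ⊢ x ◁ F ▷ y ≐ y
  ⊢CP2 x y = subst (sub x y T T T) (axiom (cp CP2))

  ⊢CP3 : ∀ x → CPcr ⊢ T ◁ x ▷ F ≐ x
  ⊢CP3 x = subst (const x) (axiom (cp (CP3 {A = A})))

  ⊢CP4 : ∀ x y z u v → CPcr ⊢ x ◁ (y ◁ z ▷ u) ▷ v ≐ (x ◁ y ▷ v) ◁ z ▷ (x ◁ u ▷ v)
  ⊢CP4 x y z u v = subst (sub x y z u v) (axiom (cp CP4))

  ⊢CPcr1 : ∀ α x y z → CPcr ⊢ (x ◁ atom α ▷ y) ◁ atom α ▷ z ≐ x ◁ atom α ▷ z
  ⊢CPcr1 α x y z = subst (sub x y z T T) (axiom (CPcr1 α))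

  ⊢CPcr2 : ∀ α x y z → CPcr ⊢ x ◁ atom α ▷ (y ◁ atom α ▷ z) ≐ x ◁ atom α ▷ z
  ⊢CPcr2 α x y z = subst (sub x y z T T) (axiom (CPcr2 α))

  infix 3 _∥_≈_

  -- Provable equality in the position just below the last atom of the path,
  -- on the side selected by its reply.
  _∥_≈_ : Path → OpenTerm A → OpenTerm A → Set a
  []              ∥ p ≈ q = CPcr ⊢ p ≐ q
  (α , true)  ∷ _ ∥ p ≈ q = ∀ z → CPcr ⊢ p ◁ atom α ▷ z ≐ q ◁ atom α ▷ z
  (α , false) ∷ _ ∥ p ≈ q = ∀ z → CPcr ⊢ z ◁ atom α ▷ p ≐ z ◁ atom α ▷ q

  ∥-lift : ∀ h {p q} → CPcr ⊢ p ≐ q → h ∥ p ≈ q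
  ∥-lift []                d   = d
  ∥-lift ((α , true)  ∷ h) d z = cong d refl refl
  ∥-lift ((α , false) ∷ h) d z = cong refl refl d

  ∥-trans : ∀ h {p q r} → h ∥ p ≈ q → h ∥ q ≈ r → h ∥ p ≈ r
  ∥-trans []                d e   = trans d e
  ∥-trans ((α , true)  ∷ h) d e z = trans (d z) (e z)
  ∥-trans ((α , false) ∷ h) d e z = trans (d z) (e z)

  -- The terms `p b` are the same for all paths, while `k b h′` may be simplified for its path.
  -- `CP4` handles conditionals; when `α` heads the path, `CPcr1` or `CPcr2` discards the
  -- unreachable branch.
  expand-correct : ∀ t h k (p : Bool → OpenTerm A) → (∀ b h′ → h′ ∥ p b ≈ ⌈ k b h′ ⌉) →
                   h ∥ p true ◁ ⌈ t ⌉ ▷ p false ≈ ⌈ expand t h k ⌉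
  expand-correct T h k p pk = ∥-trans h (∥-lift h (⊢CP1 _ _)) (pk true h)
  expand-correct F h k p pk = ∥-trans h (∥-lift h (⊢CP2 _ _)) (pk false h)
  expand-correct (atom α) h k p pk with known α h in eq
  -- One branch is replaced at a time, the other being the arbitrary term in the definition of
  -- `_∥_≈_`.
  ... | nothing = ∥-lift h (trans (pk true  ((α , true)  ∷ h) (p false))
                                  (pk false ((α , false) ∷ h) _))
  ... | just b with known-just α h eq
  expand-correct (atom α) h k p pk | just true  | h′ , ≡.refl =
    ∥-trans h (⊢CPcr1 α _ _) (pk true h)
  expand-correct (atom α) h k p pk | just false | h′ , ≡.refl =
    ∥-trans h (λ z → ⊢CPcr2 α z _ _) (pk false h)
  expand-correct (x ◁ y ▷ z) h k p pk =
    ∥-trans h (∥-lift h (⊢CP4 _ _ _ _ _))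
      (expand-correct y h _ p′
        λ { true  h′ → expand-correct x h′ k p pk
          ; false h′ → expand-correct z h′ k p pk })
    where
    p′ : Bool → OpenTerm A
    p′ true  = p true ◁ ⌈ x ⌉ ▷ p false
    p′ false = p true ◁ ⌈ z ⌉ ▷ p false

  nf-correct : ∀ t → CPcr ⊢ ⌈ t ⌉ ≐ ⌈ nf t ⌉
  -- `CP3` puts `t` into the shape of a conditional with branches `leaf true` and `leaf false`.
  nf-correct t = trans (sym (⊢CP3 ⌈ t ⌉))
    (expand-correct t [] _ (λ b → ⌈ leaf b ⌉)
      λ { true h → ∥-lift h refl ; false h → ∥-lift h refl })

  -- Separation of distinct normal forms

  final : Bool × State → Path
  final (_ , h , _) = h

  run-extends : ∀ t h q → ∃ λ w → final (run t (h , q)) ≡ w ++ h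
  run-extends T h q = [] , ≡.refl
  run-extends F h q = [] , ≡.refl
  run-extends (atom α) h q with known α h
  ... | just _  = [] , ≡.refl
  ... | nothing = (α , q 0) ∷ [] , ≡.refl
  run-extends (x ◁ y ▷ z) h q with run y (h , q) | run-extends y h q
  ... | b , _ , q′ | w , ≡.refl = extend b
    where
    append : ∀ {h′} → (∃ λ w′ → h′ ≡ w′ ++ (w ++ h)) → ∃ λ w′ → h′ ≡ w′ ++ h
    append (w′ , e) = w′ ++ w , ≡.trans e (≡.sym (++-assoc w′ w h))

    extend : ∀ b → ∃ λ w′ → final (branch (run x) (run z) (b , w ++ h , q′)) ≡ w′ ++ h
    extend true  = append (run-extends x (w ++ h) q′)
    extend false = append (run-extends z (w ++ h) q′)

  run-node : ∀ {α h} l r q → known α h ≡ nothing →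
             run (l ◁ atom α ▷ r) (h , q) ≡
             branch (run l) (run r) (q 0 , (α , q 0) ∷ h , q ∘ suc)
  run-node l r q eq rewrite eq = ≡.refl

  -- The bracketing exposes the suffix `h` for cancellation and leaves the query at the root as the
  -- last remaining entry.
  run-node-extends : ∀ {α h} l r q → known α h ≡ nothing →
                     ∃ λ w → final (run (l ◁ atom α ▷ r) (h , q)) ≡ (w ++ (α , q 0) ∷ []) ++ h
  run-node-extends {α} {h} l r q eq rewrite eq = side (q 0)
    where
    reassoc : ∀ {b h′} → (∃ λ w → h′ ≡ w ++ (α , b) ∷ h) → ∃ λ w → h′ ≡ (w ++ (α , b) ∷ []) ++ h
    reassoc {b} (w , e) = w , ≡.trans e (≡.sym (++-assoc w ((α , b) ∷ []) h))

    side : ∀ b → ∃ λ w → final (branch (run l) (run r) (b , (α , b) ∷ h , q ∘ suc)) ≡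
                         (w ++ (α , b) ∷ []) ++ h
    side true  = reassoc (run-extends l _ _)
    side false = reassoc (run-extends r _ _)

  run-node-≢ : ∀ {α h} l r q → known α h ≡ nothing → final (run (l ◁ atom α ▷ r) (h , q)) ≢ h
  run-node-≢ {α} {h} l r q eq stays with run-node-extends l r q eq
  ... | w , e with ++-conicalʳ w ((α , q 0) ∷ [])
                     (++-cancelʳ h (w ++ (α , q 0) ∷ []) [] (≡.trans (≡.sym e) stays))
  ... | ()

  -- Once `h` is cancelled from the common final path, its last entry names both roots.
  roots-≡ : ∀ {α β h} l r l′ r′ q → known α h ≡ nothing → known β h ≡ nothing →
            run (l ◁ atom α ▷ r) (h , q) ≡ run (l′ ◁ atom β ▷ r′) (h , q) → α ≡ β
  roots-≡ {h = h} l r l′ r′ q eq eq′ same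
    with run-node-extends l r q eq | run-node-extends l′ r′ q eq′
  ... | w , e | w′ , e′ = ≡.cong proj₁ (∷ʳ-injectiveʳ w w′ (++-cancelʳ h _ _
          (≡.trans (≡.sym e) (≡.trans (≡.cong final same) e′))))

  cons : Bool → (ℕ → Bool) → ℕ → Bool
  cons b q zero    = b
  cons b q (suc n) = q n

  normal-separated : ∀ {h t t′} → Normal h t → Normal h t′ →
                     (∀ q → run t (h , q) ≡ run t′ (h , q)) → t ≡ t′
  normal-separated T T same = ≡.refl
  normal-separated F F same = ≡.refl
  -- Any stream serves here, since leaves read no replies.
  normal-separated T F same with same (const true)
  ... | ()
  normal-separated F T same with same (const true)
  ... | ()
  normal-separated T (node {l = l} {r} eq _ _) same =
    contradiction (≡.sym (≡.cong final (same (const true)))) (run-node-≢ l r _ eq)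
  normal-separated F (node {l = l} {r} eq _ _) same =
    contradiction (≡.sym (≡.cong final (same (const true)))) (run-node-≢ l r _ eq)
  normal-separated (node {l = l} {r} eq _ _) T same =
    contradiction (≡.cong final (same (const true))) (run-node-≢ l r _ eq)
  normal-separated (node {l = l} {r} eq _ _) F same =
    contradiction (≡.cong final (same (const true))) (run-node-≢ l r _ eq)
  normal-separated {h} (node {α} {l} {r} eq nl nr) (node {β} {l′} {r′} eq′ nl′ nr′) same
    with roots-≡ {α} {β} {h} l r l′ r′ (const true) eq eq′ (same (const true))
  ... | ≡.refl = ≡.cong₂ (_◁ atom α ▷_)
          (normal-separated nl nl′ (same-child true))
          (normal-separated nr nr′ (same-child false))
    where
    same-child : ∀ b q → branch (run l) (run r) (b , (α , b) ∷ h , q) ≡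
                         branch (run l′) (run r′) (b , (α , b) ∷ h , q)
    -- The stream `cons b q` forces the reply `b` at the root and leaves `q` for the chosen child.
    same-child b q = ≡.trans (≡.sym (run-node l r (cons b q) eq))
      (≡.trans (same (cons b q)) (run-node l′ r′ (cons b q) eq′))

  -- Completeness on closed terms

  nf-≃ : ∀ t → t ≃ nf t
  nf-≃ t = ⊢⇒≃ t (nf t) (nf-correct t)

  -- States with the empty path suffice, as `nf` yields terms normal relative to `[]`.
  ≃⇒nf-≡ : ∀ {t t′} → t ≃ t′ → nf t ≡ nf t′
  ≃⇒nf-≡ {t} {t′} e = normal-separated (nf-normal t) (nf-normal t′) λ q →
    ≡.trans (≡.sym (at (nf-≃ t) ([] , q))) (≡.trans (at e ([] , q)) (at (nf-≃ t′) ([] , q)))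

  ≃⇒⊢ : ∀ t t′ → t ≃ t′ → CPcr ⊢ ⌈ t ⌉ ≐ ⌈ t′ ⌉
  ≃⇒⊢ t t′ e with nf t′ | ≃⇒nf-≡ e | nf-correct t′
  ... | _ | ≡.refl | d = trans (nf-correct t) (sym d)

  -- The stateful proposition algebra

  reply : ClosedTerm A → State → ClosedTerm A
  reply x s = leaf (proj₁ (run x s))

  apply : ClosedTerm A → State → State
  apply x s = proj₂ (run x s)

  s₀ : State
  s₀ = [] , const true

  leaf-injective : ∀ b b′ → leaf b ≃ leaf b′ → b ≡ b′
  leaf-injective true  true  e = ≡.refl
  leaf-injective false false e = ≡.refl
  leaf-injective true  false e with at e s₀
  ... | ()
  leaf-injective false true  e with at e s₀
  ... | ()

  -- Meant for normal forms: there, being equal to `T` or `F` in the algebra is visible in the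
  -- syntax, so composing with `nf` respects `≃`. The default `s₀` is the constant required by
  -- `TS3`.
  select : State → ClosedTerm A → State → State
  select s T s′ = s
  select s F s′ = s′
  select s _ s′ = s₀

  spa : SPA A a a
  spa = record
    { reduct      = 𝔸cr
    ; states      = ≡.setoid State
    ; const       = s₀
    ; condₛ       = λ s x s′ → select s (nf x) s′
    ; _•_         = apply
    ; _!_         = reply
    ; condₛ-cong  = λ { {s} {r = r} ≡.refl e ≡.refl → ≡.cong (λ u → select s u r) (≃⇒nf-≡ e) }
    ; •-cong      = λ { {s = s} e ≡.refl → ≡.cong proj₂ (at e s) }
    ; !-cong      = λ { {s = s} e ≡.refl → reflexive (≡.cong (leaf ∘ proj₁) (at e s)) }
    ; satisfiesCP = ⊨CP
    ; TS1         = λ _ _ → ≡.refl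
    ; TS2         = λ _ _ → ≡.refl
    ; TS3         = undecided
    ; SPA1        = λ _ → ≈.refl
    ; SPA2        = λ _ → ≈.refl
    ; SPA3        = reply-cond
    ; SPA4        = λ _ → ≡.refl
    ; SPA5        = λ _ → ≡.refl
    ; SPA6        = apply-cond
    ; SPA7        = λ x s → leaf-T⊎F (proj₁ (run x s))
    -- Reply and resulting state together determine `run`, which is all that `≃` compares.
    ; SPA8        = λ x y r e → pointwise λ s →
        ≡.cong₂ _,_ (leaf-injective _ _ (r s)) (e s)
    }
    where
    module ≈ = Setoid ≃-setoid
    open ≈ using (_≉_; reflexive)

    undecided : ∀ x s s′ → x ≉ T → x ≉ F → select s (nf x) s′ ≡ s₀
    undecided x s s′ x≉T x≉F with nf x | nf-≃ x | nf-normal x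
    ... | _ | e | T          = contradiction e x≉T
    ... | _ | e | F          = contradiction e x≉F
    ... | _ | e | node _ _ _ = ≡.refl

    reply-cond : ∀ x y z s →
      reply (x ◁ y ▷ z) s ≃ reply x (apply y s) ◁ reply y s ▷ reply z (apply y s)
    reply-cond x y z s with run y s
    ... | true  , _ = pointwise λ _ → ≡.refl
    ... | false , _ = pointwise λ _ → ≡.refl

    apply-cond : ∀ x y z s →
      apply (x ◁ y ▷ z) s ≡ select (apply x (apply y s)) (nf (reply y s)) (apply z (apply y s))
    apply-cond x y z s with run y s
    ... | true  , _ = ≡.refl
    ... | false , _ = ≡.refl

    leaf-T⊎F : ∀ b → leaf b ≃ T ⊎ leaf b ≃ F
    leaf-T⊎F true  = inj₁ ≈.refl
    leaf-T⊎F false = inj₂ ≈.refl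

theorem5 : {a : Level} (A : Set a) → IsAtomSet A → MoreThanOne A →
    Σ (CEAlgebra A a a) λ 𝔸cr → IsHMA 𝔸cr ×
    ((t t′ : ClosedTerm A) →
    (CPcr ⊢ (⌈ t ⌉ ≐ ⌈ t′ ⌉)) ⇔ (𝔸cr ⊨ (⌈ t ⌉ ≐ ⌈ t′ ⌉)))
theorem5 A atoms _ =
  𝔸cr _≟_ , (spa _≟_ , ≡.refl) ,
  λ t t′ → mk⇔ (⊢-sound (𝔸cr _≟_) (⊨CPcr _≟_)) (≃⇒⊢ _≟_ t t′ ∘ ⊨⇒≃ _≟_ t t′)
  where
  _≟_ : DecidableEquality A
  _≟_ = atom-≟ atoms
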